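{- Let $n\ge 3$ and $x\in S_n$ avoid $123$. Then there exists $1\le i\le n-2$ with $|\mathrm{Act}_i(x;123)|=|\mathrm{Act}_{i+1}(x;123)|\le|\mathrm{Act}_{i+2}(x;123)|$ if and only if $x$ contains the bivincular pattern $132^{\star}$.
   Context: For $w=w_1\cdots w_{m}\in S_{m}$ and $1\le i\le m+1$, let $w^i$ be the permutation obtained by inserting $m+1$ immediately before $w_i$ (at the end if $i=m+1$). For a pattern $y$, site $i$ of $w$ is active with respect to $y$ if $w^i$ avoids $y$ (has no subsequence order-isomorphic to $y$). For $x\in S_n$ and $1\le k\le n$, let $\mathrm{small}_k(x)$ be the subsequence of $x$ formed by the entries $1,\dots,k$ (a permutation in $S_k$). For $1\le j\le n$, $\mathrm{Act}_j(x;y)$ is the set of active sites of $\mathrm{small}_{n+1-j}(x)$ with respect to $y$. (The word $|\mathrm{Act}_1(x;y)|\cdots|\mathrm{Act}_{n-1}(x;y)|$ is West's signature of $x$.) An occurrence of the bivincular pattern $132^{\star}$ in $x$ is a pair of indices $a<b<n$ with $x_a<x_{b+1}$ and $x_b=x_{b+1}+1$. -}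

module Defs where

open import Data.Fin.Base using (Fin; toℕ; cast)
open import Data.Fin.Properties using (all?)
open import Data.Fin.Subset using (Subset)
open import Data.List.Base using (List; []; _∷_; length; lookup; map; upTo; filter; insertAt)
open import Data.List.Relation.Binary.Permutation.Propositional using (_↭_)
open import Data.List.Relation.Binary.Sublist.Propositional using (_⊆_; []; _∷_; _∷ʳ_)
open import Data.Nat.Base using (ℕ; suc; _<_; _∸_)
open import Data.Nat.Properties using (_≟_; _<?_; _≤?_)
open import Data.Product.Base using (Σ; ∃; _×_; _,_; proj₁; proj₂)
open import Data.Sum.Base using (inj₁; inj₂; [_,_])
open import Data.Vec.Base using (tabulate)
open import Function.Base using (_∘_)
open import Function.Bundles using (_⇔_; mk⇔; Equivalence)
open import Relation.Binary.PropositionalEquality using (_≡_; refl)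
open import Relation.Nullary.Decidable using (Dec; yes; no; does; map′; _×-dec_; _→-dec_; _⊎-dec_; ¬?)
open import Relation.Nullary.Negation using (¬_)

-- Permutations are words in one-line notation, with letters 1, …, n.
Word : Set
Word = List ℕ

infix 4 _∈S_
_∈S_ : Word → ℕ → Set
x ∈S n = x ↭ map suc (upTo n)

OrderIsomorphic : Word → Word → Set
OrderIsomorphic u v = Σ (length u ≡ length v) λ eq → ∀ i j →
  lookup u i < lookup u j ⇔ lookup v (cast eq i) < lookup v (cast eq j)

Contains : Word → Word → Set
Contains w y = ∃ λ s → s ⊆ w × OrderIsomorphic y s

Avoids : Word → Word → Set
Avoids w y = ¬ Contains w y

private
  ⇔-dec : ∀ {A B : Set} → Dec A → Dec B → Dec (A ⇔ B)
  ⇔-dec a b = map′ (λ (f , g) → mk⇔ f g)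
                   (λ e → Equivalence.to e , Equivalence.from e)
                   ((a →-dec b) ×-dec (b →-dec a))

  anySublist? : {P : Word → Set} → (∀ s → Dec (P s)) →
                ∀ w → Dec (∃ λ s → s ⊆ w × P s)
  anySublist? P? [] = map′ (λ p → [] , [] , p) (λ { (_ , [] , p) → p }) (P? [])
  anySublist? P? (x ∷ w) =
    map′ [ (λ (s , s⊆w , p) → s , x ∷ʳ s⊆w , p)
         , (λ (s , s⊆w , p) → x ∷ s , refl ∷ s⊆w , p) ]
         (λ { (s , _ ∷ʳ s⊆w , p)     → inj₁ (s , s⊆w , p)
            ; (_ , refl ∷ s⊆w , p) → inj₂ (_ , s⊆w , p) })
         (anySublist? P? w ⊎-dec anySublist? (P? ∘ (x ∷_)) w)

orderIsomorphic? : ∀ u v → Dec (OrderIsomorphic u v)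
orderIsomorphic? u v with length u ≟ length v
... | no  neq = no (neq ∘ proj₁)
... | yes eq  = map′ (eq ,_) proj₂
  (all? λ i → all? λ j →
    ⇔-dec (lookup u i <? lookup u j) (lookup v (cast eq i) <? lookup v (cast eq j)))

contains? : ∀ w y → Dec (Contains w y)
contains? w y = anySublist? (orderIsomorphic? y) w

avoids? : ∀ w y → Dec (Avoids w y)
avoids? w y = ¬? (contains? w y)

-- Sites are numbered from 0: the site i : Fin (m + 1) is site i + 1 in the
-- usual numbering 1, …, m + 1, where m = length w.
Site : Word → Set
Site w = Fin (suc (length w))

insertMax : (w : Word) → Site w → Word
insertMax w i = insertAt w i (suc (length w))

Active : Word → (w : Word) → Site w → Set
Active y w i = Avoids (insertMax w i) y

active? : ∀ y w i → Dec (Active y w i)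
active? y w i = avoids? (insertMax w i) y

activeSites : Word → (w : Word) → Subset (suc (length w))
activeSites y w = tabulate (does ∘ active? y w)

small : ℕ → Word → Word
small k = filter (_≤? k)

-- Meant for 1 ≤ j ≤ n, where n = length x.
Act : (j : ℕ) (x y : Word) → Subset (suc (length (small (suc (length x) ∸ j) x)))
Act j x y = activeSites y (small (suc (length x) ∸ j) x)

-- The position c plays the role of b + 1, so that b < n is implicit.
Contains132⋆ : Word → Set
Contains132⋆ x = ∃ λ (a : Fin (length x)) → ∃ λ (b : Fin (length x)) → ∃ λ (c : Fin (length x)) →
  toℕ a < toℕ b × toℕ c ≡ suc (toℕ b) ×
  lookup x a < lookup x c × lookup x b ≡ suc (lookup x c)

[123] : Word
[123] = 1 ∷ 2 ∷ 3 ∷ []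

{-# OPTIONS --safe #-}

-- Inserting the maximum into a 123-avoiding word creates a 123 exactly when an
-- ascent precedes it, so the number of active sites is one more than the length
-- of the initial descending run.  If suc k stands first in small (suc k) x, then
-- this run is one longer than that of small k x; otherwise it ends just before
-- suc k, and is no longer than that of small k x.  Hence the condition on the
-- signature says that k + 1 and k + 2 are both preceded by smaller letters, and by
-- equally many letters ≤ k.  Then k + 2 precedes k + 1 with only larger letters
-- in between, and any such letter would complete a 123.
module Submission where

open import Defs
open import Data.Bool.Base using (Bool; true; false)
open import Data.Empty using (⊥-elim)
open import Data.Fin.Base using (Fin; zero; suc; toℕ; cast)
open import Data.Fin.Properties using (toℕ≤pred[n])
open import Data.Fin.Subset using (∣_∣)
open import Data.List.Base using ([]; _∷_; [_]; _++_; length; lookup; map; upTo; take; drop; insertAt)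
open import Data.List.Membership.Propositional using (_∈_)
open import Data.List.Membership.Propositional.Properties using (∈-∃++; ∈-++⁻; ∈-++⁺ˡ; ∈-++⁺ʳ; ∈-map⁺; ∈-map⁻; ∈-upTo⁺; ∈-upTo⁻; ∈-filter⁺; ∈-filter⁻; ∈-length)
open import Data.List.Properties using (++-assoc; filter-++; filter-accept; filter-reject; filter-none; length-++; length-map; length-upTo; length-take; ++-identityʳ; take++drop≡id)
open import Data.List.Relation.Binary.Permutation.Propositional using (↭-sym; ↭⇒↭ₛ)
open import Data.List.Relation.Binary.Permutation.Propositional.Properties using (∈-resp-↭; ↭-length)
open import Data.List.Relation.Binary.Permutation.Setoid.Properties using (Unique-resp-↭)
open import Data.List.Relation.Binary.Sublist.Propositional using (_⊆_; []; _∷_; _∷ʳ_; ⊆-trans; minimum; from∈; to∈)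
open import Data.List.Relation.Binary.Sublist.Propositional.Properties using (filter-⊆; ++⁺)
open import Data.List.Relation.Unary.All as All using (All; []; _∷_)
import Data.List.Relation.Unary.All.Properties as All
open import Data.List.Relation.Unary.AllPairs using (AllPairs; []; _∷_)
open import Data.List.Relation.Unary.Any using (here; there)
open import Data.List.Relation.Unary.Linked using (Linked; []; [-]; _∷_)
open import Data.List.Relation.Unary.Linked.Properties using (Linked⇒AllPairs)
open import Data.List.Relation.Unary.Unique.Propositional using (Unique)
import Data.List.Relation.Unary.Unique.Propositional.Properties as Unique
open import Data.Nat.Base using (ℕ; zero; suc; _+_; _∸_; _≤_; _<_; _≥_; z≤n; s≤s; s≤s⁻¹; z<s)
open import Data.Nat.Properties
open import Data.Product.Base using (∃; ∃₂; _×_; _,_; proj₁; proj₂)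
open import Data.Sum.Base using (_⊎_; inj₁; inj₂)
open import Data.Vec.Base using (tabulate)
open import Function.Base using (_∘_)
open import Function.Bundles using (_⇔_; mk⇔; Equivalence)
open import Relation.Binary.PropositionalEquality using (_≡_; _≢_; refl; sym; trans; cong; cong₂; subst; subst₂; setoid)
open import Relation.Nullary.Decidable using (yes; no; dec-true; dec-false)
open import Relation.Nullary.Negation using (¬_; contradiction)

-- Avoiding 123

-- A working form of avoidance: the order isomorphism is unfolded to two comparisons, so that
-- exhibiting three letters already gives a contradiction.
Free123 : Word → Set
Free123 w = ∀ {a b c} → a ∷ b ∷ c ∷ [] ⊆ w → a < b → ¬ b < c

Free123-⊆ : ∀ {v w} → v ⊆ w → Free123 w → Free123 v
Free123-⊆ v⊆w free s⊆v = free (⊆-trans s⊆v v⊆w)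

increasing-≅-[123] : ∀ {a b c} → a < b → b < c → OrderIsomorphic [123] (a ∷ b ∷ c ∷ [])
increasing-≅-[123] {a} {b} {c} a<b b<c = refl , iso
  where
  both : ∀ {A B : Set} → A → B → A ⇔ B
  both x y = mk⇔ (λ _ → y) (λ _ → x)

  neither : ∀ {A B : Set} → ¬ A → ¬ B → A ⇔ B
  neither ¬x ¬y = mk⇔ (⊥-elim ∘ ¬x) (⊥-elim ∘ ¬y)

  iso : ∀ (i j : Fin 3) → lookup [123] i < lookup [123] j ⇔
    lookup (a ∷ b ∷ c ∷ []) (cast refl i) < lookup (a ∷ b ∷ c ∷ []) (cast refl j)
  iso zero             zero             = neither (<-irrefl refl) (<-irrefl refl)
  iso zero             (suc zero)       = both (s≤s (s≤s z≤n)) a<b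
  iso zero             (suc (suc zero)) = both (s≤s (s≤s z≤n)) (<-trans a<b b<c)
  iso (suc zero)       zero             = neither (λ { (s≤s ()) }) (<-asym a<b)
  iso (suc zero)       (suc zero)       = neither (<-irrefl refl) (<-irrefl refl)
  iso (suc zero)       (suc (suc zero)) = both (s≤s (s≤s (s≤s z≤n))) b<c
  iso (suc (suc zero)) zero             = neither (λ { (s≤s ()) }) (<-asym (<-trans a<b b<c))
  iso (suc (suc zero)) (suc zero)       = neither (λ { (s≤s (s≤s ())) }) (<-asym b<c)
  iso (suc (suc zero)) (suc (suc zero)) = neither (<-irrefl refl) (<-irrefl refl)

avoids⇒free : ∀ {w} → Avoids w [123] → Free123 w
avoids⇒free avoids s⊆w a<b b<c = avoids (_ , s⊆w , increasing-≅-[123] a<b b<c)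

free⇒avoids : ∀ {w} → Free123 w → Avoids w [123]
free⇒avoids free (a ∷ b ∷ c ∷ [] , s⊆w , refl , iso) =
  free s⊆w (Equivalence.to (iso zero (suc zero)) (s≤s (s≤s z≤n)))
           (Equivalence.to (iso (suc zero) (suc (suc zero))) (s≤s (s≤s (s≤s z≤n))))

AllPairs-pair : ∀ {R : ℕ → ℕ → Set} {w a b} → AllPairs R w → a ∷ b ∷ [] ⊆ w → R a b
AllPairs-pair (_ ∷ rs) (_ ∷ʳ s)    = AllPairs-pair rs s
AllPairs-pair (r ∷ _)  (refl ∷ s) = All.lookup r (to∈ s)

pairs⇒AllPairs : ∀ {R : ℕ → ℕ → Set} w → (∀ {a b} → a ∷ b ∷ [] ⊆ w → R a b) → AllPairs R w
pairs⇒AllPairs []      _ = []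
pairs⇒AllPairs (a ∷ w) r = All.tabulate (λ b∈w → r (refl ∷ from∈ b∈w)) ∷ pairs⇒AllPairs w (r ∘ (a ∷ʳ_))

-- Sorts occurrences by the role of the inserted letter: the length of `s₁` tells which letter of
-- the pattern `m` plays.
⊆-insert⁻ : ∀ {s : Word} u {m v} → s ⊆ u ++ m ∷ v →
  s ⊆ u ++ v ⊎ ∃₂ λ s₁ s₂ → s ≡ s₁ ++ m ∷ s₂ × s₁ ⊆ u × s₂ ⊆ v
⊆-insert⁻ []      (_ ∷ʳ s)   = inj₁ s
⊆-insert⁻ []      (refl ∷ s) = inj₂ ([] , _ , refl , [] , s)
⊆-insert⁻ (a ∷ u) (_ ∷ʳ s) with ⊆-insert⁻ u s
... | inj₁ p                            = inj₁ (a ∷ʳ p)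
... | inj₂ (s₁ , s₂ , eq , s₁⊆u , s₂⊆v) = inj₂ (s₁ , s₂ , eq , a ∷ʳ s₁⊆u , s₂⊆v)
⊆-insert⁻ (a ∷ u) (refl ∷ s) with ⊆-insert⁻ u s
... | inj₁ p                            = inj₁ (refl ∷ p)
... | inj₂ (s₁ , s₂ , eq , s₁⊆u , s₂⊆v) = inj₂ (a ∷ s₁ , s₂ , cong (a ∷_) eq , refl ∷ s₁⊆u , s₂⊆v)

-- Only as the last letter of an occurrence can the maximum be used.
free-insert⁺ : ∀ u {m v} → All (_< m) (u ++ v) → AllPairs _≥_ u → Free123 (u ++ v) → Free123 (u ++ m ∷ v)
free-insert⁺ u {m} {v} <m desc free s a<b b<c with ⊆-insert⁻ u s
... | inj₁ s′ = free s′ a<b b<c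
... | inj₂ ([] , _ , refl , _ , s₂) =
  <-asym a<b (All.lookup (All.++⁻ʳ u <m) (to∈ (⊆-trans (refl ∷ _ ∷ʳ []) s₂)))
... | inj₂ (_ ∷ [] , _ , refl , _ , s₂) = <-asym b<c (All.lookup (All.++⁻ʳ u <m) (to∈ s₂))
... | inj₂ (_ ∷ _ ∷ [] , _ , refl , s₁ , _) = <⇒≱ a<b (AllPairs-pair desc s₁)
... | inj₂ (_ ∷ _ ∷ _ ∷ [] , _ , () , _)
... | inj₂ (_ ∷ _ ∷ _ ∷ _ ∷ _ , _ , () , _)

-- An ascent inside `u` would be completed to a 123 by the larger `m` after it.
free-insert⁻ : ∀ u {m v} → All (_< m) u → Free123 (u ++ m ∷ v) → AllPairs _≥_ u
free-insert⁻ u <m free = pairs⇒AllPairs u λ s →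
  ≮⇒≥ λ a<b → free (++⁺ s (refl ∷ minimum _)) a<b (All.lookup <m (to∈ (⊆-trans (_ ∷ʳ refl ∷ []) s)))

-- The initial descending run

-- The head is kept apart to make the recursion structural. Descents are weak, as the exact negation
-- of the ascent `a < b`.
runFrom : ℕ → Word → ℕ
runFrom a []      = 1
runFrom a (b ∷ w) with a <? b
... | yes _ = 1
... | no  _ = suc (runFrom b w)

run : Word → ℕ
run []      = 0
run (a ∷ w) = runFrom a w

runFrom≤ : ∀ a w → runFrom a w ≤ suc (length w)
runFrom≤ a []      = ≤-refl
runFrom≤ a (b ∷ w) with a <? b
... | yes _ = s≤s z≤n
... | no  _ = s≤s (runFrom≤ b w)

run≤length : ∀ w → run w ≤ length w
run≤length []      = z≤n
run≤length (a ∷ w) = runFrom≤ a w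

run-++ : ∀ {u} v → AllPairs _≥_ u → length u ≤ run (u ++ v)
run-++ {[]}        v       _ = z≤n
run-++ {a ∷ []}    []      _ = ≤-refl
run-++ {a ∷ []}    (b ∷ v) _ with a <? b
... | yes _ = ≤-refl
... | no  _ = s≤s z≤n
run-++ {a ∷ b ∷ u} v ((a≥b ∷ _) ∷ desc) with a <? b
... | yes a<b = contradiction a≥b (<⇒≱ a<b)
... | no  _   = s≤s (run-++ v desc)

-- The step up to `m` stops the run. The prefix has to be nonempty, since a leading `m` would start
-- the run instead.
run-ascent : ∀ {a u m} v → AllPairs _≥_ (a ∷ u) → All (_< m) (a ∷ u) → run (a ∷ u ++ m ∷ v) ≡ suc (length u)
run-ascent {a} {[]} {m} v _ (a<m ∷ _) with a <? m
... | yes _   = refl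
... | no  a≮m = contradiction a<m a≮m
run-ascent {a} {b ∷ u} v ((a≥b ∷ _) ∷ desc) (_ ∷ <m) with a <? b
... | yes a<b = contradiction a≥b (<⇒≱ a<b)
... | no  _   = cong suc (run-ascent v desc <m)

run-max-∷ : ∀ {m v} → All (_< m) v → run (m ∷ v) ≡ suc (run v)
run-max-∷ []        = refl
run-max-∷ {m} {b ∷ v} (b<m ∷ _) with m <? b
... | yes m<b = contradiction m<b (<-asym b<m)
... | no  _   = refl

-- `runFrom` compares neighbours only, hence `Linked`; transitivity turns this into `AllPairs` where
-- it is used.
take-runFrom : ∀ i a w → i < runFrom a w → Linked _≥_ (a ∷ take i w)
take-runFrom zero    a w       _ = [-]
take-runFrom (suc i) a []      _ = [-]
take-runFrom (suc i) a (b ∷ w) i< with a <? b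
... | yes _   = contradiction (s≤s⁻¹ i<) λ ()
... | no  a≮b = ≮⇒≥ a≮b ∷ take-runFrom i b w (s≤s⁻¹ i<)

take-run : ∀ {i} w → i ≤ run w → Linked _≥_ (take i w)
take-run {zero}  w       _  = []
take-run {suc i} (a ∷ w) i≤ = take-runFrom i a w i≤

-- Active sites

insertAt-take-drop : ∀ (w : Word) i m → insertAt w i m ≡ take (toℕ i) w ++ m ∷ drop (toℕ i) w
insertAt-take-drop w       zero    m = refl
insertAt-take-drop (a ∷ w) (suc i) m = cong (a ∷_) (insertAt-take-drop w i m)

module _ {w} (free : Free123 w) (w≤ : All (_≤ length w) w) where

  private
    pre suf : Site w → Word
    pre i = take (toℕ i) w
    suf i = drop (toℕ i) w

    pre++suf≡w : ∀ i → pre i ++ suf i ≡ w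
    pre++suf≡w i = take++drop≡id (toℕ i) w

    <max : All (_< suc (length w)) w
    <max = All.map s≤s w≤

  ≤run⇒active : ∀ i → toℕ i ≤ run w → Active [123] w i
  ≤run⇒active i i≤run rewrite insertAt-take-drop w i (suc (length w)) =
    free⇒avoids (free-insert⁺ (pre i)
      (subst (All _) (sym (pre++suf≡w i)) <max)
      (Linked⇒AllPairs (λ p q → ≤-trans q p) (take-run w i≤run))
      (subst Free123 (sym (pre++suf≡w i)) free))

  active⇒≤run : ∀ i → Active [123] w i → toℕ i ≤ run w
  active⇒≤run i active rewrite insertAt-take-drop w i (suc (length w)) =
    -- The prefix before an active site descends, so it lies within the run; its length is `toℕ i`
    -- because a site is at most `length w`.
    subst₂ _≤_ (trans (length-take (toℕ i) w) (m≤n⇒m⊓n≡m (toℕ≤pred[n] i))) (cong run (pre++suf≡w i))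
      (run-++ (suf i) (free-insert⁻ (pre i) (All.take⁺ (toℕ i) <max) (avoids⇒free active)))

∣tabulate∣-initial : ∀ {n} (f : Fin n → Bool) {r} → r ≤ n →
  (∀ i → toℕ i < r → f i ≡ true) → (∀ i → r ≤ toℕ i → f i ≡ false) → ∣ tabulate f ∣ ≡ r
∣tabulate∣-initial {zero}  f {zero}  _   _   _   = refl
∣tabulate∣-initial {suc n} f {zero}  _   _   out rewrite out zero z≤n =
  ∣tabulate∣-initial (f ∘ suc) z≤n (λ _ ()) (λ i _ → out (suc i) z≤n)
∣tabulate∣-initial {suc n} f {suc r} r≤n ins out rewrite ins zero z<s =
  cong suc (∣tabulate∣-initial (f ∘ suc) (s≤s⁻¹ r≤n) (λ i → ins (suc i) ∘ s≤s) (λ i → out (suc i) ∘ s≤s))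

-- The active sites are those numbered 0 to `run w`, both included, whence the extra one.
∣activeSites∣ : ∀ {w} → Free123 w → All (_≤ length w) w → ∣ activeSites [123] w ∣ ≡ suc (run w)
∣activeSites∣ {w} free w≤ = ∣tabulate∣-initial _ (s≤s (run≤length w))
  (λ i i≤run → dec-true (active? [123] w i) (≤run⇒active free w≤ i (s≤s⁻¹ i≤run)))
  (λ i run<i → dec-false (active? [123] w i) (<⇒≱ run<i ∘ active⇒≤run free w≤ i))

-- Small letters

unique-split : ∀ (u : Word) {m v} → Unique (u ++ m ∷ v) → All (_≢ m) u × All (_≢ m) v
unique-split []      (m≢ ∷ _)  = [] , All.map (_∘ sym) m≢
unique-split (a ∷ u) (a≢ ∷ !u) with unique-split u !u
... | u≢ , v≢ = All.head (All.++⁻ʳ u a≢) ∷ u≢ , v≢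

small-suc : ∀ {k w} → All (_≢ suc k) w → small (suc k) w ≡ small k w
small-suc [] = refl
small-suc {k} {a ∷ w} (a≢ ∷ w≢) with a ≤? k
... | yes a≤k = trans (filter-accept (_≤? suc k) (m≤n⇒m≤1+n a≤k))
                  (trans (cong (a ∷_) (small-suc w≢)) (sym (filter-accept (_≤? k) a≤k)))
... | no  a≰k = trans (filter-reject (_≤? suc k) λ a≤1+k → a≰k (s≤s⁻¹ (≤∧≢⇒< a≤1+k a≢)))
                  (trans (small-suc w≢) (sym (filter-reject (_≤? k) a≰k)))

small-delete : ∀ {k m} u v → k < m → small k (u ++ m ∷ v) ≡ small k u ++ small k v
small-delete {k} u v k<m =
  trans (filter-++ (_≤? k) u _) (cong (small k u ++_) (filter-reject (_≤? k) (<⇒≱ k<m)))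

small-insert : ∀ {k} u v → Unique (u ++ suc k ∷ v) →
  small (suc k) (u ++ suc k ∷ v) ≡ small k u ++ suc k ∷ small k v
small-insert {k} u v !x with unique-split u !x
... | u≢ , v≢ = trans (filter-++ (_≤? suc k) u _) (cong₂ _++_ (small-suc u≢)
  (trans (filter-accept (_≤? suc k) ≤-refl) (cong (suc k ∷_) (small-suc v≢))))

small≤ : ∀ k w → All (_≤ k) (small k w)
small≤ k w = All.all-filter (_≤? k) w

small-⊆ : ∀ k w → small k w ⊆ w
small-⊆ k w = filter-⊆ (_≤? k) w

∈-small⁻ : ∀ {a} k w → a ∈ small k w → a ∈ w × a ≤ k
∈-small⁻ k w = ∈-filter⁻ (_≤? k) {xs = w}

length-++-injʳ : ∀ (u : Word) {v} → length u ≡ length (u ++ v) → v ≡ []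
length-++-injʳ u {[]}    _  = refl
length-++-injʳ u {_ ∷ _} eq = contradiction (trans eq (length-++ u)) (m≢1+m+n _ ∘ (λ e → trans e (+-suc _ _)))

nonempty⇒∈ : ∀ {w : Word} → 0 < length w → ∃ (_∈ w)
nonempty⇒∈ {a ∷ _} _ = a , here refl

-- Change of the run when the next letter is added

runSmall : ℕ → Word → ℕ
runSmall k x = run (small k x)

-- Here `suc k` leads its small word and, being the maximum, descends into the old run.
run-small-first : ∀ {k} U V → let x = U ++ suc k ∷ V in Unique x → length (small k U) ≡ 0 →
  runSmall (suc k) x ≡ suc (runSmall k x)
run-small-first {k} U V !x u≡0 rewrite small-insert U V !x | small-delete U V (n<1+n k)
  with [] ← small k U = run-max-∷ (All.map s≤s (small≤ k V))

-- The letters up to `k` before `suc k` must descend, or `suc k` would complete a 123. The ascent to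
-- `suc k` ends the run after them; without `suc k` the run may go on.
run-small-later : ∀ {k} U V → let x = U ++ suc k ∷ V; u = small k U in Unique x → Free123 x → 0 < length u →
  runSmall (suc k) x ≡ length u × length u ≤ runSmall k x
run-small-later {k} U V !x free 0<u
  -- `free′` is introduced before the rewriting, so that its word is also brought into the form with
  -- `suc k` inserted.
  with free′ ← Free123-⊆ (small-⊆ (suc k) _) free
  rewrite small-insert U V !x | small-delete U V (n<1+n k)
  with a ∷ u ← small k U | <m ← All.map s≤s (small≤ k U) =
  let desc = free-insert⁻ (a ∷ u) <m free′ in
  run-ascent (small k V) desc <m , run-++ (small k V) desc

-- A leading `suc k` would lengthen the run, so some smaller letter precedes it. The word is given
-- up to an equation because the same `x` is split in several ways.
run-small-≤ : ∀ {k x} U V → x ≡ U ++ suc k ∷ V → Unique x → Free123 x →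
  runSmall (suc k) x ≤ runSmall k x →
  0 < length (small k U) × runSmall (suc k) x ≡ length (small k U)
run-small-≤ U V refl !x free run≤ = 0<u , proj₁ (run-small-later U V !x free 0<u)
  where
  0<u = n≢0⇒n>0 λ u≡0 → 1+n≰n (≤-trans (≤-reflexive (sym (run-small-first U V !x u≡0))) run≤)

-- Plateaus and 132⋆

-- An occurrence of 132⋆ by letters instead of indices: `a`, `2 + k` and `1 + k` play 1, 3 and 2.
-- The shift by `k` matches the three levels of the signature.
PeakSplit : ℕ → Word → Set
PeakSplit k x = ∃₂ λ U V → x ≡ U ++ suc (suc k) ∷ suc k ∷ V × ∃ λ a → a ∈ U × a ≤ k

-- Both runs end after the letters up to `k` in `U`: those before `2 + k` and those before `1 + k`
-- are the same, the two letters being adjacent.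
split⇒plateau : ∀ {k x} → Unique x → Free123 x → PeakSplit k x →
  runSmall (2 + k) x ≡ runSmall (1 + k) x × runSmall (1 + k) x ≤ runSmall k x
split⇒plateau {k} !x free (U , V , refl , a , a∈U , a≤k) =
  trans (proj₁ upper) (trans (cong length u≡u′) (sym (proj₁ lower))) ,
  ≤-trans (≤-reflexive (proj₁ lower)) (proj₂ lower)
  where
  U′ = U ++ [ 2 + k ]

  x≡ : U ++ 2 + k ∷ 1 + k ∷ V ≡ U′ ++ 1 + k ∷ V
  x≡ = sym (++-assoc U _ _)

  1+k∉U : All (_≢ suc k) U
  1+k∉U = All.++⁻ˡ U (proj₁ (unique-split U′ (subst Unique x≡ !x)))

  small-U′ : small k U ≡ small k U′
  small-U′ = sym (trans (small-delete U [] (n≤1+n _)) (++-identityʳ _))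

  u≡u′ : small (1 + k) U ≡ small k U′
  u≡u′ = trans (small-suc 1+k∉U) small-U′

  upper = run-small-later U _ !x free (∈-length (∈-filter⁺ (_≤? suc k) a∈U (m≤n⇒m≤1+n a≤k)))

  lower : runSmall (1 + k) (U ++ 2 + k ∷ 1 + k ∷ V) ≡ length (small k U′)
        × length (small k U′) ≤ runSmall k (U ++ 2 + k ∷ 1 + k ∷ V)
  lower = subst (λ x → runSmall (1 + k) x ≡ length (small k U′) × length (small k U′) ≤ runSmall k x) (sym x≡)
    (run-small-later U′ V (subst Unique x≡ !x) (subst Free123 x≡ free)
      (∈-length (∈-filter⁺ (_≤? k) (∈-++⁺ˡ a∈U) a≤k)))

plateau⇒split : ∀ {k x} → Unique x → Free123 x → 1 + k ∈ x → 2 + k ∈ x →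
  runSmall (2 + k) x ≡ runSmall (1 + k) x → runSmall (1 + k) x ≤ runSmall k x → PeakSplit k x
plateau⇒split {k} {x} !x free 1+k∈x 2+k∈x run≡ run≤
  with U′ , V′ , x≡′ ← ∈-∃++ 1+k∈x
  with 0<u′ , run≡u′ ← run-small-≤ U′ V′ x≡′ !x free run≤
  = cases (∈-++⁻ U′ (subst (2 + k ∈_) x≡′ 2+k∈x))
  where
  1+k∉U′ : All (_≢ 1 + k) U′
  1+k∉U′ = proj₁ (unique-split U′ (subst Unique x≡′ !x))

  -- The two equal runs become two equal counts, of letters up to `1 + k` before `2 + k` and of
  -- letters up to `k` before `1 + k`.
  sizes : ∀ U V → x ≡ U ++ 2 + k ∷ V → length (small (1 + k) U) ≡ length (small k U′)
  sizes U V x≡ = trans (sym (proj₂ (run-small-≤ U V x≡ !x free (≤-reflexive run≡)))) (trans run≡ run≡u′)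

  -- If `1 + k` came first, it would itself be counted on the left of `sizes` but not on the right.
  after : ∀ M V → x ≢ U′ ++ 1 + k ∷ M ++ 2 + k ∷ V
  after M V x≡ = m≢1+m+n _ (trans (sym (sizes U V (trans x≡ (sym (++-assoc U′ _ _))))) length-u)
    where
    U = U′ ++ 1 + k ∷ M

    length-u : length (small (1 + k) U) ≡ suc (length (small k U′) + length (small (1 + k) M))
    length-u = trans (cong length (trans (filter-++ (_≤? suc k) U′ _)
      (cong₂ _++_ (small-suc 1+k∉U′) (filter-accept (_≤? suc k) ≤-refl))))
      (trans (length-++ (small k U′)) (+-suc _ _))

  before : ∀ U M → U′ ≡ U ++ 2 + k ∷ M → PeakSplit k x
  before U M refl = U , V′ , subst (λ M → x ≡ U ++ 2 + k ∷ M ++ 1 + k ∷ V′) M≡[] x≡ , a , a∈U , a≤k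
    where
    x≡ : x ≡ U ++ 2 + k ∷ M ++ 1 + k ∷ V′
    x≡ = trans x≡′ (++-assoc U _ _)

    u′≡ : small k (U ++ 2 + k ∷ M) ≡ small k U ++ small k M
    u′≡ = small-delete U M (n≤1+n _)

    -- By `sizes`, no letter up to `k` is gained between `2 + k` and `1 + k`.
    small-M≡[] : small k M ≡ []
    small-M≡[] = length-++-injʳ (small k U)
      (trans (cong length (sym (small-suc (All.++⁻ˡ U 1+k∉U′)))) (trans (sizes U _ x≡) (cong length u′≡)))

    -- The small letter known to precede `1 + k` is not in the gap `M`, so it already precedes
    -- `2 + k`.
    0<u : 0 < length (small k U)
    0<u = subst (λ w → 0 < length w) (trans u′≡ (trans (cong (small k U ++_) small-M≡[]) (++-identityʳ _))) 0<u′

    u-letter : ∃ (_∈ small k U)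
    u-letter = nonempty⇒∈ 0<u

    a = proj₁ u-letter

    a∈U : a ∈ U
    a∈U = proj₁ (∈-small⁻ k U (proj₂ u-letter))

    a≤k : a ≤ k
    a≤k = proj₂ (∈-small⁻ k U (proj₂ u-letter))

    2+k∉M : All (_≢ 2 + k) M
    2+k∉M = All.++⁻ˡ M (proj₂ (unique-split U (subst Unique x≡ !x)))

    1+k∉M : All (_≢ 1 + k) M
    1+k∉M = All.tail (All.++⁻ʳ U 1+k∉U′)

    M-larger : ∀ {m} → m ∈ M → 2 + k < m
    M-larger {m} m∈M = ≤∧≢⇒< (≤∧≢⇒< (≰⇒> m≰k) (All.lookup 1+k∉M m∈M ∘ sym)) (All.lookup 2+k∉M m∈M ∘ sym)
      where
      m≰k : ¬ m ≤ k
      m≰k m≤k with () ← subst (m ∈_) small-M≡[] (∈-filter⁺ (_≤? k) m∈M m≤k)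

    no-∈ : ∀ {w : Word} → (∀ {m} → ¬ m ∈ w) → w ≡ []
    no-∈ {[]}    _  = refl
    no-∈ {_ ∷ _} ∉w = contradiction (here refl) ∉w

    M≡[] : M ≡ []
    -- A letter `m` of the gap would make `a`, `2 + k`, `m` a 123.
    M≡[] = no-∈ λ m∈M → free
      (subst (a ∷ 2 + k ∷ _ ∷ [] ⊆_) (sym x≡) (++⁺ (from∈ a∈U) (refl ∷ from∈ (∈-++⁺ˡ m∈M))))
      (s≤s (m≤n⇒m≤1+n a≤k)) (M-larger m∈M)

  cases : 2 + k ∈ U′ ⊎ 2 + k ∈ 1 + k ∷ V′ → PeakSplit k x
  cases (inj₁ 2+k∈U′) = let U , M , U′≡ = ∈-∃++ 2+k∈U′ in before U M U′≡
  -- The omitted case `here` would identify `2 + k` with `1 + k`.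
  cases (inj₂ (there 2+k∈V′)) = let M , V , V′≡ = ∈-∃++ 2+k∈V′ in
    contradiction (trans x≡′ (cong (λ w → U′ ++ 1 + k ∷ w) V′≡)) (after M V)

-- Passing between indices and splits

adjacent-split : ∀ (x : Word) b c → toℕ c ≡ suc (toℕ b) →
  ∃₂ λ U V → x ≡ U ++ lookup x b ∷ lookup x c ∷ V
adjacent-split (_ ∷ _ ∷ x) zero    (suc zero) _  = [] , x , refl
adjacent-split (y ∷ x)     (suc b) (suc c)    eq =
  let U , V , x≡ = adjacent-split x b c (suc-injective eq) in y ∷ U , V , cong (y ∷_) x≡

preceded-split : ∀ (x : Word) a b c → toℕ a < toℕ b → toℕ c ≡ suc (toℕ b) →
  ∃₂ λ U V → x ≡ U ++ lookup x b ∷ lookup x c ∷ V × lookup x a ∈ U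
preceded-split (y ∷ x) zero (suc b) (suc c) _ eq =
  let U , V , x≡ = adjacent-split x b c (suc-injective eq) in y ∷ U , V , cong (y ∷_) x≡ , here refl
preceded-split (y ∷ x) (suc a) (suc b) (suc c) a<b eq =
  let U , V , x≡ , a∈U = preceded-split x a b c (s≤s⁻¹ a<b) (suc-injective eq)
  in  y ∷ U , V , cong (y ∷_) x≡ , there a∈U

132⋆⇒split : ∀ {x} → All (1 ≤_) x → Contains132⋆ x → ∃ λ k → 1 ≤ k × PeakSplit k x
132⋆⇒split {x} pos (a , b , c , a<b , c≡1+b , xa<xc , xb≡)
  with U , V , x≡ , a∈U ← preceded-split x a b c a<b c≡1+b = result (lookup x c) x≡ xb≡ xa<xc
  where
  -- The looked-up letters become variables in order to be matched on. The smaller letter excludes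
  -- `q` being zero, and its positivity yields `1 ≤ k`.
  result : ∀ q {p} → x ≡ U ++ p ∷ q ∷ V → p ≡ suc q → lookup x a < q → ∃ λ k → 1 ≤ k × PeakSplit k x
  result (suc k) x≡ refl xa<q =
    k , ≤-trans (All.lookup pos (subst (lookup x a ∈_) (sym x≡) (∈-++⁺ˡ a∈U))) (s≤s⁻¹ xa<q) ,
    U , V , x≡ , lookup x a , a∈U , s≤s⁻¹ xa<q

split⇒132⋆ : ∀ {k x} → PeakSplit k x → Contains132⋆ x
split⇒132⋆ {k} (U , V , refl , a , a∈U , a≤k) = find U a∈U
  where
  adjacent : ∀ U → ∃₂ λ b c → let x = U ++ 2 + k ∷ 1 + k ∷ V in
    toℕ {length x} c ≡ suc (toℕ {length x} b) × lookup x b ≡ 2 + k × lookup x c ≡ 1 + k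
  adjacent []      = zero , suc zero , refl , refl , refl
  adjacent (_ ∷ U) = let b , c , eq , xb , xc = adjacent U in suc b , suc c , cong suc eq , xb , xc

  find : ∀ U → a ∈ U → Contains132⋆ (U ++ 2 + k ∷ 1 + k ∷ V)
  find (_ ∷ U) (here refl) = let b , c , eq , xb , xc = adjacent U in
    zero , suc b , suc c , z<s , cong suc eq , subst (a <_) (sym xc) (s≤s a≤k) , trans xb (cong suc (sym xc))
  find (_ ∷ U) (there a∈U) = let a , b , c , a<b , eq , xa<xc , xb = find U a∈U in
    suc a , suc b , suc c , s≤s a<b , cong suc eq , xa<xc , xb

-- Permutations

SignaturePlateau : Word → ℕ → Set
SignaturePlateau x i =
  ∣ Act i x [123] ∣ ≡ ∣ Act (i + 1) x [123] ∣ × ∣ Act (i + 1) x [123] ∣ ≤ ∣ Act (i + 2) x [123] ∣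

module Permutation {n x} (x∈S : x ∈S n) where

  length≡n : length x ≡ n
  length≡n = trans (↭-length x∈S) (trans (length-map suc (upTo n)) (length-upTo n))

  unique : Unique x
  unique = Unique-resp-↭ (setoid ℕ) (↭⇒↭ₛ (↭-sym x∈S)) (Unique.map⁺ suc-injective (Unique.upTo⁺ n))

  ∈⁺ : ∀ {k} → suc k ≤ n → suc k ∈ x
  ∈⁺ k<n = ∈-resp-↭ (↭-sym x∈S) (∈-map⁺ suc (∈-upTo⁺ k<n))

  ∈⁻ : ∀ {m} → m ∈ x → 1 ≤ m × m ≤ n
  ∈⁻ m∈x with _ , j∈ , refl ← ∈-map⁻ suc (∈-resp-↭ x∈S m∈x) = z<s , ∈-upTo⁻ j∈

  positive : All (1 ≤_) x
  positive = All.tabulate (proj₁ ∘ ∈⁻)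

  -- By induction, as `suc k` occurs exactly once. Thus the letter inserted into `small k x` is
  -- `suc k`, above all others.
  length-small : ∀ {k} → k ≤ n → length (small k x) ≡ k
  length-small {zero}  _   = cong length (filter-none (_≤? 0) (All.map <⇒≱ positive))
  length-small {suc k} k<n with U , V , refl ← ∈-∃++ (∈⁺ k<n) =
    trans (cong length (small-insert U V unique)) (trans (length-++ (small k U)) (trans (+-suc _ _)
      (cong suc (trans (sym (length-++ (small k U)))
        (trans (cong length (sym (small-delete U V ≤-refl))) (length-small (<⇒≤ k<n)))))))

  ∣Act∣ : Free123 x → ∀ j {k} → k ≤ n → j + k ≡ suc n → ∣ Act j x [123] ∣ ≡ suc (runSmall k x)
  ∣Act∣ free j {k} k≤n j+k≡ = trans (cong (λ l → ∣ activeSites [123] (small l x) ∣) level)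
    (∣activeSites∣ (Free123-⊆ (small-⊆ k x) free)
      (subst (λ l → All (_≤ l) (small k x)) (sym (length-small k≤n)) (small≤ k x)))
    where
    level : suc (length x) ∸ j ≡ k
    level = trans (cong (λ l → suc l ∸ j) length≡n) (trans (cong (_∸ j) (sym j+k≡)) (m+n∸m≡n j k))

  -- Levels fall as indices rise: `i`, `i + 1`, `i + 2` read the small words of sizes `2 + k`,
  -- `1 + k`, `k`. The extra one in each cardinality cancels.
  signature⇔run : ∀ {i k} → Free123 x → 1 ≤ i → i + suc k ≡ n →
    SignaturePlateau x i ⇔ (runSmall (2 + k) x ≡ runSmall (1 + k) x × runSmall (1 + k) x ≤ runSmall k x)
  signature⇔run {i} {k} free 1≤i refl
    rewrite ∣Act∣ free i {2 + k} (+-monoˡ-≤ (suc k) 1≤i) (+-suc i (suc k))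
          | ∣Act∣ free (i + 1) {1 + k} (m≤n+m (suc k) i) (trans (+-assoc i 1 (suc k)) (+-suc i (suc k)))
          | ∣Act∣ free (i + 2) {k} (≤-trans (n≤1+n k) (m≤n+m (suc k) i)) (trans (+-assoc i 2 k) (+-suc i (suc k)))
    = mk⇔ (λ (eq , le) → suc-injective eq , s≤s⁻¹ le) (λ (eq , le) → cong suc eq , s≤s le)

theorem3p12 : (n : ℕ) → 3 ≤ n → (x : Word) → x ∈S n → Avoids x [123] →
    (∃ λ (i : ℕ) → 1 ≤ i × i ≤ n ∸ 2 ×
    ∣ Act i x [123] ∣ ≡ ∣ Act (i + 1) x [123] ∣ ×
    ∣ Act (i + 1) x [123] ∣ ≤ ∣ Act (i + 2) x [123] ∣)
    ⇔ Contains132⋆ x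
theorem3p12 n 3≤n x x∈S avoids = mk⇔ to from
  where
  open Permutation x∈S

  free : Free123 x
  free = avoids⇒free avoids

  to : (∃ λ i → 1 ≤ i × i ≤ n ∸ 2 × SignaturePlateau x i) → Contains132⋆ x
  to (i , 1≤i , i≤n∸2 , plateau) =
    let run≡ , run≤ = Equivalence.to (signature⇔run free 1≤i i+1+k≡n) plateau
    in  split⇒132⋆ (plateau⇒split unique free (∈⁺ (<⇒≤ 2+k≤n)) (∈⁺ 2+k≤n) run≡ run≤)
    where
    -- The level belonging to index `i + 2`, since n + 1 - (i + 2) = n - (i + 1).
    k = n ∸ suc i

    i<n : suc i ≤ n
    i<n = ≤-trans (s≤s i≤n∸2) (∸-monoʳ-< (s≤s z≤n) (≤-trans (n≤1+n 2) 3≤n))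

    i+1+k≡n : i + suc k ≡ n
    i+1+k≡n = trans (+-suc i k) (m+[n∸m]≡n i<n)

    2+k≤n : 2 + k ≤ n
    2+k≤n = subst (2 + k ≤_) i+1+k≡n (+-monoˡ-≤ (suc k) 1≤i)

  from : Contains132⋆ x → ∃ λ i → 1 ≤ i × i ≤ n ∸ 2 × SignaturePlateau x i
  from occ with k , 1≤k , split@(U , V , x≡ , _) ← 132⋆⇒split positive occ =
    -- The index solves `i + suc k ≡ n`. It is at most `n ∸ 2` because `1 ≤ k`, and positive because
    -- the letter `2 + k` is at most `n`.
    n ∸ suc k , 1≤i , ∸-monoʳ-≤ n (s≤s 1≤k) ,
    Equivalence.from (signature⇔run free 1≤i (m∸n+n≡m (<⇒≤ 2+k≤n))) (split⇒plateau unique free split)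
    where
    2+k≤n : 2 + k ≤ n
    2+k≤n = proj₂ (∈⁻ (subst (2 + k ∈_) (sym x≡) (∈-++⁺ʳ U (here refl))))

    1≤i : 1 ≤ n ∸ suc k
    1≤i = m<n⇒0<n∸m 2+k≤n
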